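{- $(\mathcal{W},<_0)$ is a well-founded relation.
   Context: $\mathcal{W}$ is the set of formulas of the calculus $\mathsf{RC}^0$, defined inductively by $F::=\top\mid F\land F\mid\Diamond_nF$, where $n$ ranges over $\mathbb{N}$. A sequent is an expression $A\vdash B$ with $A,B\in\mathcal{W}$. The axioms and rules of $\mathsf{RC}^0$ are: (1) $A\vdash A$; $A\vdash\top$; if $A\vdash B$ and $B\vdash C$ then $A\vdash C$; (2) $A\land B\vdash A$; $A\land B\vdash B$; if $A\vdash B$ and $A\vdash C$ then $A\vdash B\land C$; (3) if $A\vdash B$ then $\Diamond_nA\vdash\Diamond_nB$, for all $n\in\mathbb{N}$; (4) $\Diamond_n\Diamond_nA\vdash\Diamond_nA$, for every $n\in\mathbb{N}$; (5) $\Diamond_nA\vdash\Diamond_mA$, for all $n>m$; (6) $\Diamond_nA\land\Diamond_mB\vdash\Diamond_n(A\land\Diamond_mB)$, for all $n>m$. For $A,B\in\mathcal{W}$, $A<_0B$ means that $B\vdash\Diamond_0A$ is derivable in $\mathsf{RC}^0$. -}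

module Defs where

open import Data.Nat.Base using (ℕ; _>_)
open import Level using (0ℓ)
open import Relation.Binary.Core using (Rel)

infixr 7 _∧_
infix  4 _⊢_ _<₀_

data 𝒲 : Set where
  ⊤   : 𝒲
  _∧_ : 𝒲 → 𝒲 → 𝒲
  ◇   : ℕ → 𝒲 → 𝒲

-- A ⊢ B is the type of RC⁰-derivations of the sequent A ⊢ B.
data _⊢_ : Rel 𝒲 0ℓ where
  ⊢-refl  : ∀ {A} → A ⊢ A
  ⊢-⊤     : ∀ {A} → A ⊢ ⊤
  ⊢-trans : ∀ {A B C} → A ⊢ B → B ⊢ C → A ⊢ C
  ∧-elimˡ : ∀ {A B} → A ∧ B ⊢ A
  ∧-elimʳ : ∀ {A B} → A ∧ B ⊢ B
  ∧-intro : ∀ {A B C} → A ⊢ B → A ⊢ C → A ⊢ B ∧ C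
  ◇-mono  : ∀ {n A B} → A ⊢ B → ◇ n A ⊢ ◇ n B
  ◇-trans : ∀ {n A} → ◇ n (◇ n A) ⊢ ◇ n A
  ◇-lower : ∀ {n m A} → n > m → ◇ n A ⊢ ◇ m A
  ◇-∧     : ∀ {n m A B} → n > m → ◇ n A ∧ ◇ m B ⊢ ◇ n (A ∧ ◇ m B)

_<₀_ : Rel 𝒲 0ℓ
A <₀ B = B ⊢ ◇ 0 A

{-# OPTIONS --safe #-}

-- Closed formulas are interpreted in the algebra of Ignatiev sequences: finite
-- sequences x₀ , x₁ , … of ordinals below ε₀ in which x_{i+1} is at most the
-- last exponent of the Cantor normal form of x_i.  Ordered pointwise, these
-- sequences have binary joins, which interpret ∧, while ◇ n sends x to the least
-- sequence exceeding x at all indices ≤ n.  Then A ⊢ B implies that the value of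
-- A dominates the value of B.  The value of ◇ 0 B starts with the
-- successor of the first entry of the value of B, so A ↦ x₀ maps _<₀_ into the
-- order of the ordinals below ε₀.

module Submission where

open import Defs
open import Algebra.Construct.NaturalChoice.Max as Max using ()
open import Data.List.Base using (List; []; _∷_)
open import Data.List.Relation.Binary.Pointwise as Pointwise using ()
open import Data.List.Relation.Binary.Prefix.Heterogeneous using (Prefix; []; _∷_)
open import Data.List.Relation.Binary.Prefix.Heterogeneous.Properties as Prefix using ()
open import Data.Nat.Base using (ℕ; zero; suc; z<s; s<s) renaming (_<_ to _<ℕ_)
open import Data.Product.Base using (_×_; _,_)
open import Data.Sum.Base using (inj₁; inj₂)
open import Induction.WellFounded using (WellFounded; Acc; acc; module Subrelation)
open import Level using (0ℓ)
open import Relation.Binary.Bundles using (StrictTotalOrder; DecTotalOrder)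
open import Relation.Binary.Construct.On as On using ()
open import Relation.Binary.Construct.StrictToNonStrict as StrictToNonStrict using ()
open import Relation.Binary.Core using (Rel)
open import Relation.Binary.Definitions using (Transitive; Trichotomous; tri<; tri≈; tri>)
open import Relation.Binary.PropositionalEquality
  using (_≡_; _≢_; refl; sym; trans; subst; isEquivalence)
open import Relation.Binary.Properties.StrictTotalOrder as StrictTotalOrderProperties using ()
open import Relation.Binary.Structures.Biased using (isStrictTotalOrderᶜ)
open import Relation.Nullary.Decidable.Core using (yes; no)
open import Relation.Nullary.Negation.Core using (¬_; contradiction)

-- Ordinal notations below ε₀.

infix 8 ω^_+_
infix 4 _<_ _≺_ _≼_ _<[_]_

-- Raw terms, whose exponents need not descend. The lexicographic order `_<_` is total on all of
-- them but well-founded only on normal forms: writing `1` for `ω^ 𝟎 + 𝟎`, the term `ω^ 1 + 𝟎`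
-- decreases forever under repeated prefixing with `ω^ 𝟎`.
data Ord : Set where
  𝟎     : Ord
  ω^_+_ : Ord → Ord → Ord

data _<_ : Rel Ord 0ℓ where
  𝟎<     : ∀ {a b} → 𝟎 < ω^ a + b
  <-exp  : ∀ {a b c d} → a < c → ω^ a + b < ω^ c + d
  <-rest : ∀ {a b d} → b < d → ω^ a + b < ω^ a + d

<-trans : Transitive _<_
<-trans 𝟎<         (<-exp _)  = 𝟎<
<-trans 𝟎<         (<-rest _) = 𝟎<
<-trans (<-exp p)  (<-exp q)  = <-exp (<-trans p q)
<-trans (<-exp p)  (<-rest _) = <-exp p
<-trans (<-rest _) (<-exp q)  = <-exp q
<-trans (<-rest p) (<-rest q) = <-rest (<-trans p q)

<-cmp : Trichotomous _≡_ _<_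
<-cmp 𝟎          𝟎          = tri≈ (λ ()) refl (λ ())
<-cmp 𝟎          (ω^ _ + _) = tri< 𝟎< (λ ()) (λ ())
<-cmp (ω^ _ + _) 𝟎          = tri> (λ ()) (λ ()) 𝟎<
<-cmp (ω^ a + b) (ω^ c + d) with <-cmp a c
... | tri< a<c a≢c a≯c =
  tri< (<-exp a<c) (λ { refl → a≢c refl }) λ { (<-exp p) → a≯c p ; (<-rest _) → a≢c refl }
... | tri> a≮c a≢c a>c =
  tri> (λ { (<-exp p) → a≮c p ; (<-rest _) → a≢c refl }) (λ { refl → a≢c refl }) (<-exp a>c)
... | tri≈ a≮a refl _ with <-cmp b d
...   | tri< b<d b≢d b≯d =
  tri< (<-rest b<d) (λ { refl → b≢d refl }) λ { (<-exp p) → a≮a p ; (<-rest p) → b≯d p }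
...   | tri≈ b≮b refl _ = tri≈ irr refl irr
  where
  irr : ¬ (ω^ a + b < ω^ a + b)
  irr (<-exp p)  = a≮a p
  irr (<-rest p) = b≮b p
...   | tri> b≮d b≢d b>d =
  tri> (λ { (<-exp p) → a≮a p ; (<-rest p) → b≮d p }) (λ { refl → b≢d refl }) (<-rest b>d)

<-strictTotalOrder : StrictTotalOrder 0ℓ 0ℓ 0ℓ
<-strictTotalOrder = record
  { isStrictTotalOrder = isStrictTotalOrderᶜ record
    { isEquivalence = isEquivalence ; trans = <-trans ; compare = <-cmp }
  }

open StrictTotalOrder <-strictTotalOrder using () renaming (irrefl to <-irrefl)
open DecTotalOrder (StrictTotalOrderProperties.decTotalOrder <-strictTotalOrder)
  using (_≤_; _≤?_; totalOrder)
  renaming (refl to ≤-refl; trans to ≤-trans)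
open Max totalOrder using (_⊔_; ⊔-lub; ⊔-sel; x≤x⊔y; x≤y⊔x)

<-≤-trans : ∀ {a b c} → a < b → b ≤ c → a < c
<-≤-trans = StrictToNonStrict.<-≤-trans _≡_ _<_ <-trans (λ { refl p → p })

≤-<-trans : ∀ {a b c} → a ≤ b → b < c → a < c
≤-<-trans = StrictToNonStrict.≤-<-trans _≡_ _<_ sym <-trans (λ { refl p → p })

≤∧≢⇒< : ∀ {a b} → a ≤ b → a ≢ b → a < b
≤∧≢⇒< (inj₁ a<b) _   = a<b
≤∧≢⇒< (inj₂ a≡b) a≢b = contradiction a≡b a≢b

≰⇒> : ∀ {a b} → ¬ a ≤ b → b < a
≰⇒> {a} {b} a≰b with <-cmp a b
... | tri< a<b _ _ = contradiction (inj₁ a<b) a≰b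
... | tri≈ _ a≡b _ = contradiction (inj₂ a≡b) a≰b
... | tri> _ _ a>b = a>b

⊔-lub-< : ∀ {a b c} → a < c → b < c → a ⊔ b < c
⊔-lub-< {a} {b} {c} a<c b<c with ⊔-sel a b
... | inj₁ eq = subst (_< c) (sym eq) a<c
... | inj₂ eq = subst (_< c) (sym eq) b<c

𝟎≤ : ∀ a → 𝟎 ≤ a
𝟎≤ 𝟎          = ≤-refl
𝟎≤ (ω^ _ + _) = inj₁ 𝟎<

<-rest-≤ : ∀ {a b d} → b ≤ d → ω^ a + b ≤ ω^ a + d
<-rest-≤ (inj₁ b<d)  = inj₁ (<-rest b<d)
<-rest-≤ (inj₂ refl) = ≤-refl

-- Normal forms and their well-foundedness.

lead : Ord → Ord
lead 𝟎          = 𝟎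
lead (ω^ a + _) = a

data NF : Ord → Set where
  𝟎     : NF 𝟎
  ω^_+_ : ∀ {a b} → NF a → NF b → {lead b ≤ a} → NF (ω^ a + b)

-- Normality is asked of the smaller term only; as accessibility concerns predecessors, every raw
-- term is then accessible.
_≺_ : Rel Ord 0ℓ
a ≺ b = NF a × a < b

acc-𝟎 : Acc _≺_ 𝟎
acc-𝟎 = acc λ ()

-- Inner induction, on the rest `b` with the leading exponent `a` fixed; `smaller` is the outer
-- hypothesis for exponents below `a`.
acc-ω-step : ∀ {a b} → (∀ {c d} → c ≺ a → Acc _≺_ d → Acc _≺_ (ω^ c + d)) →
             Acc _≺_ b → Acc _≺_ (ω^ a + b)
acc-ω-step {a} smaller (acc rb) = acc λ
  { (_ , 𝟎<)                → acc-𝟎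
  ; (n , <-exp c<a)         → small n c<a
  ; (ω^ _ + n , <-rest d<b) → acc-ω-step smaller (rb (n , d<b))
  }
  where
  -- Exponents descend along a normal form, so the rest is again led by an exponent below `a`:
  -- recursion makes it accessible, and `smaller` adds the first summand.
  small : ∀ {d} → NF d → lead d < a → Acc _≺_ d
  small 𝟎                  _   = acc-𝟎
  small ((ω^ nc + nd) {l}) c<a = smaller (nc , c<a) (small nd (≤-<-trans l c<a))

acc-ω : ∀ {a b} → Acc _≺_ a → Acc _≺_ b → Acc _≺_ (ω^ a + b)
acc-ω (acc ra) = acc-ω-step λ c≺a → acc-ω (ra c≺a)

NF⇒acc : ∀ {a} → NF a → Acc _≺_ a
NF⇒acc 𝟎            = acc-𝟎
NF⇒acc (ω^ na + nb) = acc-ω (NF⇒acc na) (NF⇒acc nb)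

≺-wellFounded : WellFounded _≺_
≺-wellFounded _ = acc λ (n , _) → NF⇒acc n

-- Last exponents and least upper approximations.

-- The junk value 𝟎 at 𝟎 makes 𝟎 ∷ x an Ignatiev sequence only if x vanishes.
end : Ord → Ord
end 𝟎                     = 𝟎
end (ω^ a + 𝟎)            = a
end (ω^ _ + b@(ω^ _ + _)) = end b

end≤lead : ∀ {a} → NF a → end a ≤ lead a
end≤lead 𝟎                           = ≤-refl
end≤lead (ω^ _ + 𝟎)                  = ≤-refl
end≤lead ((ω^ _ + n@(ω^ _ + _)) {l}) = ≤-trans (end≤lead n) l

-- On normal forms, the least ordinal above b whose last exponent is at least g.
next : Ord → Ord → Ord
next 𝟎          g = ω^ g + 𝟎
next (ω^ a + b) g with g ≤? a
... | yes _ = ω^ a + next b g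
... | no  _ = ω^ g + 𝟎

next-> : ∀ b g → b < next b g
next-> 𝟎          g = 𝟎<
next-> (ω^ a + b) g with g ≤? a
... | yes _   = <-rest (next-> b g)
... | no  g≰a = <-exp (≰⇒> g≰a)

end-next : ∀ b g → end (next b g) ≡ g
end-next 𝟎          g = refl
end-next (ω^ a + b) g with g ≤? a
... | no  _ = refl
... | yes _ with next b g | next-> b g | end-next b g
...   | ω^ _ + _ | _ | eq = eq

lead-next : ∀ {b g a} → lead b ≤ a → g ≤ a → lead (next b g) ≤ a
lead-next {𝟎}          {g} _   g≤a = g≤a
lead-next {ω^ c + _}   {g} c≤a g≤a with g ≤? c
... | yes _ = c≤a
... | no  _ = g≤a

NF-next : ∀ {b g} → NF b → NF g → NF (next b g)
NF-next                𝟎                  ng = (ω^ ng + 𝟎) {𝟎≤ _}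
NF-next {ω^ a + b} {g} ((ω^ na + nb) {l}) ng with g ≤? a
... | yes g≤a = (ω^ na + NF-next nb ng) {lead-next {b} l g≤a}
... | no  _   = (ω^ ng + 𝟎) {𝟎≤ _}

ω^≤ : ∀ {g a b} → g ≤ a → ω^ g + 𝟎 ≤ ω^ a + b
ω^≤         (inj₁ g<a)  = inj₁ (<-exp g<a)
ω^≤ {b = b} (inj₂ refl) = <-rest-≤ (𝟎≤ b)

next-least : ∀ {b g c} → NF c → b < c → g ≤ end c → next b g ≤ c
next-least {𝟎} n 𝟎< g≤ = ω^≤ (≤-trans g≤ (end≤lead n))
next-least {ω^ a + b} {g} n b<c g≤ with g ≤? a
next-least n (<-exp a<u) g≤ | yes _ = inj₁ (<-exp a<u)
-- Since `b < v`, the rest `v` of `c` is nonzero, so `c` and `v` have the same last exponent.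
next-least {c = ω^ _ + (ω^ _ + _)} (ω^ _ + n) (<-rest b<v) g≤ | yes _ =
  <-rest-≤ (next-least n b<v g≤)
next-least {c = ω^ _ + _} n _ g≤ | no _ = ω^≤ (≤-trans g≤ (end≤lead n))

-- The last exponent of `next b g` is exactly `g`, which rules out equality with `c`.
≤∧end<⇒next< : ∀ {b g c} → next b g ≤ c → g < end c → next b g < c
≤∧end<⇒next< {b} {g} p g< = ≤∧≢⇒< p λ { refl → <-irrefl (sym (end-next b g)) g< }

next-least-< : ∀ {b g c} → NF c → b < c → g < end c → next b g < c
next-least-< {b} n b<c g< = ≤∧end<⇒next< {b} (next-least n b<c (inj₁ g<)) g<

-- The non-strict companion of `next`: on normal forms, the least ordinal from `b` upwards that may
-- precede an entry `g` in an Ignatiev sequence.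
close : Ord → Ord → Ord
close b g with g ≤? end b
... | yes _ = b
... | no  _ = next b g

close-≥ : ∀ b g → b ≤ close b g
close-≥ b g with g ≤? end b
... | yes _ = ≤-refl
... | no  _ = inj₁ (next-> b g)

end-close : ∀ b g → g ≤ end (close b g)
end-close b g with g ≤? end b
... | yes g≤ = g≤
... | no  _  = inj₂ (sym (end-next b g))

NF-close : ∀ {b g} → NF b → NF g → NF (close b g)
NF-close {b} {g} nb ng with g ≤? end b
... | yes _ = nb
... | no  _ = NF-next nb ng

close-least : ∀ {b g c} → NF c → b ≤ c → g ≤ end c → close b g ≤ c
close-least {b} {g} n b≤c g≤ with g ≤? end b
... | yes _  = b≤c
... | no  g≰ = next-least n (≤∧≢⇒< b≤c λ { refl → g≰ g≤ }) g≤

close-least-< : ∀ {b g c} → NF c → b < c → g < end c → close b g < c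
close-least-< {b} {g} n b<c g< with g ≤? end b
... | yes _ = b<c
... | no  _ = next-least-< n b<c g<

NF-⊔ : ∀ {a b} → NF a → NF b → NF (a ⊔ b)
NF-⊔ {a} {b} na nb with ⊔-sel a b
... | inj₁ eq = subst NF (sym eq) na
... | inj₂ eq = subst NF (sym eq) nb

-- Ignatiev sequences, their orders and operations.

-- Sequences are extended by zeros.
Seq : Set
Seq = List Ord

hd : Seq → Ord
hd []      = 𝟎
hd (a ∷ _) = a

tl : Seq → Seq
tl []      = []
tl (_ ∷ x) = x

data Ignatiev : Seq → Set where
  []  : Ignatiev []
  _∷_ : ∀ {a x} → NF a × hd x ≤ end a → Ignatiev x → Ignatiev (a ∷ x)

NF-hd : ∀ {x} → Ignatiev x → NF (hd x)
NF-hd []            = 𝟎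
NF-hd ((n , _) ∷ _) = n

hd-tl≤end : ∀ {x} → Ignatiev x → hd (tl x) ≤ end (hd x)
hd-tl≤end []            = ≤-refl
hd-tl≤end ((_ , p) ∷ _) = p

Ignatiev-tl : ∀ {x} → Ignatiev x → Ignatiev (tl x)
Ignatiev-tl []      = []
Ignatiev-tl (_ ∷ i) = i

_≼_ : Rel Seq 0ℓ
_≼_ = Prefix _≤_

≼-refl : ∀ {x} → x ≼ x
≼-refl = Prefix.fromPointwise (Pointwise.refl ≤-refl)

≼-trans : Transitive _≼_
≼-trans = Prefix.trans ≤-trans

hd-mono : ∀ {x y} → x ≼ y → hd x ≤ hd y
hd-mono {y = y} [] = 𝟎≤ (hd y)
hd-mono (p ∷ _)    = p

tl-mono : ∀ {x y} → x ≼ y → tl x ≼ tl y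
tl-mono []      = []
tl-mono (_ ∷ p) = p

-- Strict at the indices up to `n`, with no condition beyond them; this is the relation for which
-- `dia n x` is the least Ignatiev sequence above `x`.
_<[_]_ : Seq → ℕ → Seq → Set
x <[ zero  ] y = hd x < hd y
x <[ suc n ] y = hd x < hd y × tl x <[ n ] tl y

<[]⇒hd< : ∀ {x y} n → x <[ n ] y → hd x < hd y
<[]⇒hd< zero    p       = p
<[]⇒hd< (suc n) (p , _) = p

<[]-≼-trans : ∀ {x y z} n → x <[ n ] y → y ≼ z → x <[ n ] z
<[]-≼-trans zero    p       q = <-≤-trans p (hd-mono q)
<[]-≼-trans (suc n) (p , r) q = <-≤-trans p (hd-mono q) , <[]-≼-trans n r (tl-mono q)

≼-<[]-trans : ∀ {x y z} n → x ≼ y → y <[ n ] z → x <[ n ] z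
≼-<[]-trans zero    q p       = ≤-<-trans (hd-mono q) p
≼-<[]-trans (suc n) q (p , r) = ≤-<-trans (hd-mono q) p , ≼-<[]-trans n (tl-mono q) r

<[]-trans : ∀ {x y z} n → x <[ n ] y → y <[ n ] z → x <[ n ] z
<[]-trans zero    p       q       = <-trans p q
<[]-trans (suc n) (p , r) (q , s) = <-trans p q , <[]-trans n r s

<[]-lower : ∀ {x y m n} → m <ℕ n → x <[ n ] y → x <[ m ] y
<[]-lower {m = zero}  {suc n} _         (p , _) = p
<[]-lower {m = suc m} {suc n} (s<s m<n) (p , r) = p , <[]-lower m<n r

-- Built backwards from index `n`, where nothing follows and `next _ 𝟎` is the plain successor. Each
-- earlier entry must have the entry after it as a lower bound for its last exponent.
dia : ℕ → Seq → Seq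
dia zero    x = next (hd x) 𝟎 ∷ []
dia (suc n) x = next (hd x) (hd (dia n (tl x))) ∷ dia n (tl x)

Ignatiev-dia : ∀ n {x} → Ignatiev x → Ignatiev (dia n x)
Ignatiev-dia zero    i = (NF-next (NF-hd i) 𝟎 , 𝟎≤ _) ∷ []
Ignatiev-dia (suc n) {x} i =
  (NF-next (NF-hd i) (NF-hd t) , inj₂ (sym (end-next (hd x) _))) ∷ t
  where t = Ignatiev-dia n (Ignatiev-tl i)

dia-> : ∀ n x → x <[ n ] dia n x
dia-> zero    x = next-> (hd x) 𝟎
dia-> (suc n) x = next-> (hd x) _ , dia-> n (tl x)

-- Minimality of the tail comes first: it bounds the second entry by that of `y`, hence by the last
-- exponent of the head of `y`, as `next-least` requires.
dia-least : ∀ n {x y} → Ignatiev y → x <[ n ] y → dia n x ≼ y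
dia-least zero    {y = b ∷ y} ((n , _) ∷ _) p       = next-least n p (𝟎≤ _) ∷ []
dia-least (suc k) {y = b ∷ y} ((n , e) ∷ i) (p , r) =
  next-least n p (≤-trans (hd-mono t) e) ∷ t
  where t = dia-least k i r

-- The pointwise maximum can violate the condition on last exponents, so `close` repairs it from the
-- right.
join : Seq → Seq → Seq
join []      y       = y
join (a ∷ x) []      = a ∷ x
join (a ∷ x) (b ∷ y) = close (a ⊔ b) (hd (join x y)) ∷ join x y

Ignatiev-join : ∀ {x y} → Ignatiev x → Ignatiev y → Ignatiev (join x y)
Ignatiev-join []      j  = j
Ignatiev-join (p ∷ i) [] = p ∷ i
Ignatiev-join {a ∷ _} {b ∷ _} ((na , _) ∷ i) ((nb , _) ∷ j) =
  (NF-close (NF-⊔ na nb) (NF-hd t) , end-close (a ⊔ b) _) ∷ t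
  where t = Ignatiev-join i j

join-≽ˡ : ∀ x y → x ≼ join x y
join-≽ˡ []      y       = []
join-≽ˡ (a ∷ x) []      = ≼-refl
join-≽ˡ (a ∷ x) (b ∷ y) = ≤-trans (x≤x⊔y a b) (close-≥ (a ⊔ b) (hd (join x y)))
  ∷ join-≽ˡ x y

join-≽ʳ : ∀ x y → y ≼ join x y
join-≽ʳ []      y       = ≼-refl
join-≽ʳ (a ∷ x) []      = []
join-≽ʳ (a ∷ x) (b ∷ y) = ≤-trans (x≤y⊔x a b) (close-≥ (a ⊔ b) (hd (join x y)))
  ∷ join-≽ʳ x y

join-least : ∀ {x y z} → Ignatiev z → x ≼ z → y ≼ z → join x y ≼ z
join-least i []      q  = q
join-least i (p ∷ r) [] = p ∷ r
join-least ((n , e) ∷ i) (p ∷ r) (q ∷ s) =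
  close-least n (⊔-lub p q) (≤-trans (hd-mono t) e) ∷ t
  where t = join-least i r s

tl-join : ∀ x b y → tl (join x (b ∷ y)) ≡ join (tl x) y
tl-join []      b y = refl
tl-join (a ∷ x) b y = refl

join-[]ʳ : ∀ x → join x [] ≡ x
join-[]ʳ []      = refl
join-[]ʳ (_ ∷ _) = refl

hd-join-< : ∀ x {b y c} → NF c → hd x < c → b < c → hd (join (tl x) y) < end c →
            hd (join x (b ∷ y)) < c
hd-join-< []      n p q r = q
hd-join-< (a ∷ x) n p q r = close-least-< n (⊔-lub-< p q) r

-- The first entries of dia m y are strictly below those of z, because their
-- last exponents are strictly smaller.
join-dia-< : ∀ {m n x y z} → m <ℕ n → Ignatiev z → x <[ n ] z → dia m y ≼ z →
             join x (dia m y) <[ n ] z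
join-dia-< {zero} {suc n} {x} {y} {z} z<s i (p , r) q =
  hd-join-< x (NF-hd i) p b<c (subst (λ t → hd t < end (hd z)) (sym (join-[]ʳ (tl x))) e<) ,
  subst (_<[ n ] tl z) (sym tl≡) r
  where
  tl≡ : tl (join x (dia zero y)) ≡ tl x
  tl≡ = trans (tl-join x _ []) (join-[]ʳ (tl x))
  e< : hd (tl x) < end (hd z)
  e< = <-≤-trans (<[]⇒hd< n r) (hd-tl≤end i)
  b<c : next (hd y) 𝟎 < hd z
  b<c = ≤∧end<⇒next< {hd y} (hd-mono q) (≤-<-trans (𝟎≤ _) e<)
join-dia-< {suc m} {suc n} {x} {y} {z} (s<s m<n) i (p , r) q =
  hd-join-< x (NF-hd i) p b<c e< , subst (_<[ n ] tl z) (sym (tl-join x _ _)) t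
  where
  t : join (tl x) (dia m (tl y)) <[ n ] tl z
  t = join-dia-< m<n (Ignatiev-tl i) r (tl-mono q)
  e< : hd (join (tl x) (dia m (tl y))) < end (hd z)
  e< = <-≤-trans (<[]⇒hd< n t) (hd-tl≤end i)
  b<c : next (hd y) (hd (dia m (tl y))) < hd z
  b<c = ≤∧end<⇒next< {hd y} (hd-mono q)
    (≤-<-trans (hd-mono (join-≽ʳ (tl x) (dia m (tl y)))) e<)

-- Interpretation of formulas and soundness.

⟦_⟧ : 𝒲 → Seq
⟦ ⊤ ⟧     = []
⟦ A ∧ B ⟧ = join ⟦ A ⟧ ⟦ B ⟧
⟦ ◇ n A ⟧ = dia n ⟦ A ⟧

Ignatiev-⟦_⟧ : ∀ A → Ignatiev ⟦ A ⟧
Ignatiev-⟦ ⊤ ⟧     = []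
Ignatiev-⟦ A ∧ B ⟧ = Ignatiev-join Ignatiev-⟦ A ⟧ Ignatiev-⟦ B ⟧
Ignatiev-⟦ ◇ n A ⟧ = Ignatiev-dia n Ignatiev-⟦ A ⟧

-- By minimality of `dia`, each modal rule reduces to strictness up to the index of the modality on
-- its right-hand side.
sound : ∀ {A B} → A ⊢ B → ⟦ B ⟧ ≼ ⟦ A ⟧
sound ⊢-refl                  = ≼-refl
sound ⊢-⊤                     = []
sound (⊢-trans p q)           = ≼-trans (sound q) (sound p)
sound (∧-elimˡ {A} {B})       = join-≽ˡ ⟦ A ⟧ ⟦ B ⟧
sound (∧-elimʳ {A} {B})       = join-≽ʳ ⟦ A ⟧ ⟦ B ⟧
sound (∧-intro {A} p q)       = join-least Ignatiev-⟦ A ⟧ (sound p) (sound q)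
sound (◇-mono {n} {A} p)      =
  dia-least n Ignatiev-⟦ ◇ n A ⟧ (≼-<[]-trans n (sound p) (dia-> n ⟦ A ⟧))
sound (◇-trans {n} {A})       =
  dia-least n Ignatiev-⟦ ◇ n (◇ n A) ⟧
    (<[]-trans n (dia-> n ⟦ A ⟧) (dia-> n (dia n ⟦ A ⟧)))
sound (◇-lower {n} {m} {A} m<n) =
  dia-least m Ignatiev-⟦ ◇ n A ⟧ (<[]-lower m<n (dia-> n ⟦ A ⟧))
sound (◇-∧ {n} {m} {A} {B} m<n) =
  dia-least n Ignatiev-⟦ ◇ n A ∧ ◇ m B ⟧
    (join-dia-< m<n Ignatiev-⟦ ◇ n A ∧ ◇ m B ⟧
      (<[]-≼-trans n (dia-> n ⟦ A ⟧) (join-≽ˡ ⟦ ◇ n A ⟧ ⟦ ◇ m B ⟧))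
      (join-≽ʳ ⟦ ◇ n A ⟧ ⟦ ◇ m B ⟧))

<₀⇒≺ : ∀ {A B} → A <₀ B → hd ⟦ A ⟧ ≺ hd ⟦ B ⟧
<₀⇒≺ {A} p = NF-hd Ignatiev-⟦ A ⟧ , <-≤-trans (dia-> 0 ⟦ A ⟧) (hd-mono (sound p))

theorem6p2 : WellFounded _<₀_
theorem6p2 = Subrelation.wellFounded <₀⇒≺
  (On.wellFounded (λ A → hd ⟦ A ⟧) ≺-wellFounded)
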